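{- Let $k\ge2$ and let $a_1,\ldots,a_k$ be positive integers. The generating function $\sum_\lambda q^{\lambda_1+\cdots+\lambda_k}$ of the integer sequences $(\lambda_1,\ldots,\lambda_k)$ satisfying \[\lambda_i\ge \frac{a_i}{a_{i+1}}\lambda_{i+1}\ (1\le i\le k-1),\qquad \lambda_k\ge0\] equals \[\frac{\displaystyle\sum_{z_2=0}^{a_2-1}\sum_{z_3=0}^{a_3-1}\cdots\sum_{z_k=0}^{a_k-1} q^{\lceil a_1z_2/a_2\rceil+\sum_{i=2}^k z_i}\prod_{i=2}^{k-1}q^{\,b_i\lceil z_{i+1}/a_{i+1}-z_i/a_i\rceil}}{\prod_{i=1}^k(1-q^{b_i})},\] where $b_1=1$ and $b_i=a_1+a_2+\cdots+a_i$ for $2\le i\le k$. -}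

module Defs where

open import Data.Bool using (Bool; true; false; _∧_; if_then_else_)
open import Data.Nat as ℕ using (ℕ; zero; suc; _∸_)
open import Data.Integer as ℤ using (ℤ; +_)
open import Data.Rational as ℚ using (ℚ; ceiling; 0ℚ)
open import Data.List using (List; []; _∷_; map; concatMap; length; filterᵇ; upTo)

-- 1-based access into a list (entries outside the range read as 0).
at : List ℕ → ℕ → ℕ
at []       _             = 0
at (x ∷ xs) zero          = 0
at (x ∷ xs) (suc zero)    = x
at (x ∷ xs) (suc (suc i)) = at xs (suc i)

-- The rational number x / d  (d is always positive where used; d = 0 ↦ 0).
frac : ℕ → ℕ → ℚ
frac x zero    = 0ℚ
frac x (suc d) = (+ x) ℚ./ suc d

sumℕ : (ℕ → ℕ) → ℕ → ℕ → ℕ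
sumℕ f lo zero    = if lo ℕ.≤ᵇ 0 then f 0 else 0
sumℕ f lo (suc h) = sumℕ f lo h ℕ.+ (if lo ℕ.≤ᵇ suc h then f (suc h) else 0)

sumℤ : (ℕ → ℤ) → ℕ → ℕ → ℤ
sumℤ f lo zero    = if lo ℕ.≤ᵇ 0 then f 0 else + 0
sumℤ f lo (suc h) = sumℤ f lo h ℤ.+ (if lo ℕ.≤ᵇ suc h then f (suc h) else + 0)

bseq : (ℕ → ℕ) → ℕ → ℕ
bseq a (suc zero) = 1
bseq a i          = sumℕ a 1 i

-- Formal power series in q with integer coefficients: n ↦ [q^n].

FPS : Set
FPS = ℕ → ℤ

_⋆_ : FPS → FPS → FPS
(f ⋆ g) n = sumℤ (λ i → f i ℤ.* g (n ∸ i)) 0 n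

one : FPS
one zero    = + 1
one (suc n) = + 0

qpow : ℕ → FPS
qpow e n = if e ℕ.≡ᵇ n then + 1 else + 0

oneMinusQ : ℕ → FPS
oneMinusQ b n = one n ℤ.- qpow b n

prodS : (ℕ → FPS) → ℕ → ℕ → FPS
prodS F lo zero    = if lo ℕ.≤ᵇ 0 then F 0 else one
prodS F lo (suc h) = if lo ℕ.≤ᵇ suc h then prodS F lo h ⋆ F (suc h) else prodS F lo h

comps : ℕ → ℕ → List (List ℕ)
comps zero    zero    = [] ∷ []
comps zero    (suc n) = []
comps (suc k) n = concatMap (λ j → map (j ∷_) (comps k (n ∸ j))) (upTo (suc n))

allFrom : (ℕ → Bool) → ℕ → ℕ → Bool
allFrom P lo zero    = if lo ℕ.≤ᵇ 0 then P 0 else true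
allFrom P lo (suc h) = allFrom P lo h ∧ (if lo ℕ.≤ᵇ suc h then P (suc h) else true)

admissible : ℕ → (ℕ → ℕ) → List ℕ → Bool
admissible k a λs =
  allFrom (λ i → (frac (a i) (a (suc i)) ℚ.* frac (at λs (suc i)) 1) ℚ.≤ᵇ frac (at λs i) 1)
          1 (k ∸ 1)

lhsSeries : ℕ → (ℕ → ℕ) → FPS
lhsSeries k a n = + length (filterᵇ (admissible k a) (comps k n))

box : List ℕ → List (List ℕ)
box []       = [] ∷ []
box (c ∷ cs) = concatMap (λ z → map (z ∷_) (box cs)) (upTo c)

bounds : ℕ → (ℕ → ℕ) → List ℕ
bounds k a = map (λ j → a (2 ℕ.+ j)) (upTo (k ∸ 1))

-- exponent  ⌈a_1 z_2 / a_2⌉ + Σ_{i=2}^k z_i + Σ_{i=2}^{k-1} b_i ⌈z_{i+1}/a_{i+1} - z_i/a_i⌉,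
-- where zs = (z_2, ..., z_k), so z_i = at zs (i ∸ 1).
expo : ℕ → (ℕ → ℕ) → List ℕ → ℤ
expo k a zs =
  ceiling (frac (a 1 ℕ.* z 2) (a 2))
  ℤ.+ sumℤ (λ i → + z i) 2 k
  ℤ.+ sumℤ (λ i → (+ bseq a i) ℤ.* ceiling (frac (z (suc i)) (a (suc i)) ℚ.- frac (z i) (a i)))
           2 (k ∸ 1)
  where
  z : ℕ → ℕ
  z i = at zs (i ∸ 1)

numerator : ℕ → (ℕ → ℕ) → FPS
numerator k a n = + length (filterᵇ (λ zs → does' (expo k a zs) n) (box (bounds k a)))
  where
  does' : ℤ → ℕ → Bool
  does' (+ m) n = m ℕ.≡ᵇ n
  does' _     _ = false

denominator : ℕ → (ℕ → ℕ) → FPS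
denominator k a = prodS (λ i → oneMinusQ (bseq a i)) 1 k

{-# OPTIONS --safe #-}

-- Summing out λ₁, …, λ_k in this order, suppose the exponent e(x) accumulated so far, as a function
-- of the current variable x = λ_i, satisfies e(x + p) = e(x) + b with p = a_i and b = b_i (p = b = 1
-- when i = 1). Writing x = z + m p with z < p, the constraint imposed by y = λ_{i+1} reads m ≥ m₀(z, y),
-- so multiplying by 1 − q^b telescopes the geometric series in m and leaves the exponents
-- e(z) + m₀(z, y) b + y for z < p. As functions of y these are again quasiperiodic, with period a_{i+1}
-- and increment b_{i+1}, and the residues z become the summation variables of the numerator.

module Submission where

open import Defs
open import Data.Bool using (Bool; true; false; T; _∧_; if_then_else_)
open import Data.Bool.Properties using (T-≡; ⇔→≡; ∧-assoc; ∧-identityʳ)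
open import Data.Fin using (toℕ)
open import Data.Fin.Properties using (toℕ<n)
open import Data.List using (List; []; _∷_; map; concatMap; length; filterᵇ; applyUpTo; _++_)
open import Data.List.Properties using (map-upTo)
open import Data.List.Relation.Binary.Pointwise using (Pointwise; []; _∷_)
open import Data.Nat as ℕ using (ℕ; zero; suc; _≤_; _<_; z≤n; s≤s; _≤ᵇ_; _∸_)
import Data.Nat.Properties as ℕ
import Data.Nat.Tactic.RingSolver as ℕ
open import Data.Integer as ℤ using (ℤ; +_; ∣_∣; _+_; _-_; _*_)
import Data.Integer.Properties as ℤ
import Data.Integer.DivMod as ℤ
import Data.Integer.Tactic.RingSolver as ℤ
open import Algebra.Properties.CommutativeMonoid.Sum ℤ.+-0-commutativeMonoid
  using (sum; sum-cong-≗; ∑-comm; sum-replicate-zero)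
open import Data.Rational as ℚ using (ℚ; mkℚ; ceiling; ↥_; ↧_; toℚᵘ)
import Data.Rational.Properties as ℚ
open import Data.Rational.Unnormalised as ℚᵘ using (ℚᵘ; mkℚᵘ; *≡*; *≤*)
import Data.Rational.Unnormalised.Properties as ℚᵘ
open import Data.Product using (Σ; _,_; proj₁; proj₂)
open import Function using (_⇔_; mk⇔; Equivalence; _∘_; id)
open import Function.Properties.Equivalence using () renaming (sym to ⇔-sym; trans to ⇔-trans)
open import Relation.Binary.PropositionalEquality

open Equivalence using (to; from)

-- Ceilings of rationals

T-⇔⇒≡ : ∀ {x y} → T x ⇔ T y → x ≡ y
T-⇔⇒≡ x⇔y = ⇔→≡ (⇔-trans (⇔-sym T-≡) (⇔-trans x⇔y T-≡))

≤ᵇ-⇔ : ∀ {m n} → T (m ℕ.≤ᵇ n) ⇔ m ℕ.≤ n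
≤ᵇ-⇔ = mk⇔ (ℕ.≤ᵇ⇒≤ _ _) ℕ.≤⇒≤ᵇ

-- `frac` reduces to lowest terms, which hides the numerators; over unnormalised rationals the
-- comparison is a plain cross-multiplication.
frac-*-≤ᵇ : ∀ p q .{{_ : ℕ.NonZero q}} x y →
            ((frac p q ℚ.* frac y 1) ℚ.≤ᵇ frac x 1) ≡ (p ℕ.* y ℕ.≤ᵇ q ℕ.* x)
frac-*-≤ᵇ p q@(suc d) x y = T-⇔⇒≡ (mk⇔ (ℕ.≤⇒≤ᵇ ∘ fwd ∘ ℚ.toℚᵘ-mono-≤ ∘ ℚ.≤ᵇ⇒≤)
                                     (ℚ.≤⇒≤ᵇ ∘ ℚ.toℚᵘ-cancel-≤ ∘ bwd ∘ ℕ.≤ᵇ⇒≤ (p ℕ.* y) (q ℕ.* x)))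
  where
  u v : ℚᵘ
  u = mkℚᵘ (+ p) d ℚᵘ.* mkℚᵘ (+ y) 0
  v = mkℚᵘ (+ x) 0
  u≃ : toℚᵘ (frac p q ℚ.* frac y 1) ℚᵘ.≃ u
  u≃ = ℚᵘ.≃-trans (ℚ.toℚᵘ-homo-* (frac p q) (frac y 1))
         (ℚᵘ.*-cong (ℚ.toℚᵘ-fromℚᵘ (mkℚᵘ (+ p) d)) (ℚ.toℚᵘ-fromℚᵘ (mkℚᵘ (+ y) 0)))
  v≃ : toℚᵘ (frac x 1) ℚᵘ.≃ v
  v≃ = ℚ.toℚᵘ-fromℚᵘ v
  lhs≡ : + p ℤ.* + y ℤ.* + 1 ≡ + (p ℕ.* y)
  lhs≡ = trans (ℤ.*-identityʳ _) (sym (ℤ.pos-* p y))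
  rhs≡ : + x ℤ.* + (q ℕ.* 1) ≡ + (q ℕ.* x)
  rhs≡ = trans (sym (ℤ.pos-* x (q ℕ.* 1)))
               (cong +_ (trans (cong (x ℕ.*_) (ℕ.*-identityʳ q)) (ℕ.*-comm x q)))
  fwd : toℚᵘ (frac p q ℚ.* frac y 1) ℚᵘ.≤ toℚᵘ (frac x 1) → p ℕ.* y ℕ.≤ q ℕ.* x
  fwd h with ℚᵘ.≤-respʳ-≃ v≃ (ℚᵘ.≤-respˡ-≃ u≃ h)
  ... | *≤* h′ = ℤ.drop‿+≤+ (subst₂ ℤ._≤_ lhs≡ rhs≡ h′)
  bwd : p ℕ.* y ℕ.≤ q ℕ.* x → toℚᵘ (frac p q ℚ.* frac y 1) ℚᵘ.≤ toℚᵘ (frac x 1)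
  bwd h = ℚᵘ.≤-respʳ-≃ (ℚᵘ.≃-sym v≃) (ℚᵘ.≤-respˡ-≃ (ℚᵘ.≃-sym u≃)
            (*≤* (subst₂ ℤ._≤_ (sym lhs≡) (sym rhs≡) (ℤ.+≤+ h))))

floor-% : ∀ r → ↥ r ≡ + (↥ r ℤ.% ↧ r) ℤ.+ ℚ.floor r ℤ.* ↧ r
floor-% r@(mkℚ _ _ _) = ℤ.a≡a%n+[a/n]*n (↥ r) (↧ r)

-- `ceiling r` is minus the floor of `- r`, so dividing `- n` by `d` with remainder gives n = ⌈r⌉ d
-- - rem with 0 ≤ rem < d, and both directions follow from this.
ceiling-≤ : ∀ r c → ceiling r ℤ.≤ c ⇔ ↥ r ℤ.≤ c ℤ.* ↧ r
ceiling-≤ r@(mkℚ n d-1 _) c = mk⇔ fwd bwd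
  where
  d = suc d-1
  rem = ↥ (ℚ.- r) ℤ.% ↧ (ℚ.- r)
  q = ℚ.floor (ℚ.- r)
  n≡ : n ≡ ℤ.- q ℤ.* + d ℤ.- + rem
  n≡ = begin
    n                                       ≡⟨ ℤ.neg-involutive n ⟨
    ℤ.- (ℤ.- n)                             ≡⟨ cong ℤ.-_ (ℚ.↥-neg r) ⟨
    ℤ.- ↥ (ℚ.- r)                           ≡⟨ cong ℤ.-_ (floor-% (ℚ.- r)) ⟩
    ℤ.- (+ rem ℤ.+ q ℤ.* ↧ (ℚ.- r))         ≡⟨ cong (λ e → ℤ.- (+ rem ℤ.+ q ℤ.* e)) (ℚ.↧-neg r) ⟩
    ℤ.- (+ rem ℤ.+ q ℤ.* + d)               ≡⟨ lem (+ rem) q (+ d) ⟩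
    ℤ.- q ℤ.* + d ℤ.- + rem                 ∎
    where
    open ≡-Reasoning
    lem : ∀ a b e → ℤ.- (a ℤ.+ b ℤ.* e) ≡ ℤ.- b ℤ.* e ℤ.- a
    lem = ℤ.solve-∀
  rem<d : + rem ℤ.< + d
  rem<d = subst (λ e → + rem ℤ.< e) (ℚ.↧-neg r) (ℤ.+<+ (ℤ.n%d<d (↥ (ℚ.- r)) (↧ (ℚ.- r))))
  fwd : ceiling r ℤ.≤ c → n ℤ.≤ c ℤ.* + d
  fwd h = begin
    n                         ≡⟨ n≡ ⟩
    ℤ.- q ℤ.* + d ℤ.- + rem   ≤⟨ ℤ.i≤j⇒i-k≤j (+ rem) ℤ.≤-refl ⟩
    ℤ.- q ℤ.* + d             ≤⟨ ℤ.*-monoʳ-≤-nonNeg (+ d) h ⟩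
    c ℤ.* + d                 ∎
    where open ℤ.≤-Reasoning
  bwd : n ℤ.≤ c ℤ.* + d → ceiling r ℤ.≤ c
  bwd h = ℤ.≮⇒≥ λ c<-q → ℤ.<-irrefl refl (begin-strict
    n                                   ≤⟨ h ⟩
    c ℤ.* + d                           ≡⟨ lem c (+ d) ⟩
    (ℤ.suc c) ℤ.* + d ℤ.- + d           ≤⟨ ℤ.+-monoˡ-≤ _ (ℤ.*-monoʳ-≤-nonNeg (+ d) (ℤ.i<j⇒suc[i]≤j c<-q)) ⟩
    ℤ.- q ℤ.* + d ℤ.- + d               <⟨ ℤ.+-monoʳ-< (ℤ.- q ℤ.* + d) (ℤ.neg-mono-< rem<d) ⟩
    ℤ.- q ℤ.* + d ℤ.- + rem             ≡⟨ n≡ ⟨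
    n                                   ∎)
    where
    open ℤ.≤-Reasoning
    lem : ∀ a e → a ℤ.* e ≡ (+ 1 ℤ.+ a) ℤ.* e ℤ.- e
    lem = ℤ.solve-∀

-- Any fraction s/(e+1) equal to r can stand in for its lowest terms, because scaling by positive
-- denominators preserves and reflects the inequality.
ceiling-≤ᵘ : ∀ r s e → toℚᵘ r ℚᵘ.≃ mkℚᵘ s e → ∀ c → ceiling r ℤ.≤ c ⇔ s ℤ.≤ c ℤ.* + suc e
ceiling-≤ᵘ r@(mkℚ n d-1 _) s e (*≡* n*E≡s*d) c = ⇔-trans (ceiling-≤ r c) (mk⇔ fwd bwd)
  where
  D E : ℤ
  D = + suc d-1
  E = + suc e
  swap : ∀ a b c → a ℤ.* b ℤ.* c ≡ a ℤ.* c ℤ.* b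
  swap = ℤ.solve-∀
  fwd : n ℤ.≤ c ℤ.* D → s ℤ.≤ c ℤ.* E
  fwd h = ℤ.*-cancelʳ-≤-pos s (c ℤ.* E) D
            (subst₂ ℤ._≤_ n*E≡s*d (swap c D E) (ℤ.*-monoʳ-≤-nonNeg E h))
  bwd : s ℤ.≤ c ℤ.* E → n ℤ.≤ c ℤ.* D
  bwd h = ℤ.*-cancelʳ-≤-pos n (c ℤ.* D) E
            (subst₂ ℤ._≤_ (sym n*E≡s*d) (swap c E D) (ℤ.*-monoʳ-≤-nonNeg D h))

-- The last hypothesis says s/(e+1) > -1, whereas a ceiling of at most -1 would force s ≤ -(e+1).
ceiling-nonNeg : ∀ r s e → toℚᵘ r ℚᵘ.≃ mkℚᵘ s e → ℤ.- (+ e) ℤ.≤ s → + 0 ℤ.≤ ceiling r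
ceiling-nonNeg r s e r≃ -e≤s = ℤ.≮⇒≥ λ c<0 → ℤ.<-irrefl refl (begin-strict
    s                                 ≤⟨ to (ceiling-≤ᵘ r s e r≃ (ceiling r)) ℤ.≤-refl ⟩
    ceiling r ℤ.* + suc e             ≤⟨ ℤ.*-monoʳ-≤-nonNeg (+ suc e) (ℤ.i<j⇒i≤pred[j] c<0) ⟩
    ℤ.- (+ 1) ℤ.* + suc e             ≡⟨ ℤ.-1*i≡-i (+ suc e) ⟩
    ℤ.- (+ suc e)                     <⟨ ℤ.neg-mono-< (ℤ.+<+ (ℕ.n<1+n e)) ⟩
    ℤ.- (+ e)                         ≤⟨ -e≤s ⟩
    s ∎)
  where open ℤ.≤-Reasoning

∣ceiling∣-≤ : ∀ r s e → toℚᵘ r ℚᵘ.≃ mkℚᵘ s e → ℤ.- (+ e) ℤ.≤ s →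
              ∀ m → ∣ ceiling r ∣ ℕ.≤ m ⇔ s ℤ.≤ + (m ℕ.* suc e)
∣ceiling∣-≤ r s e r≃ -e≤s m = ⇔-trans
  (mk⇔ (subst (ℤ._≤ + m) eq ∘ ℤ.+≤+) (ℤ.drop‿+≤+ ∘ subst (ℤ._≤ + m) (sym eq)))
  (subst (λ t → ceiling r ℤ.≤ + m ⇔ s ℤ.≤ t) (sym (ℤ.pos-* m (suc e))) (ceiling-≤ᵘ r s e r≃ (+ m)))
  where
  eq : + ∣ ceiling r ∣ ≡ ceiling r
  eq = ℤ.0≤i⇒+∣i∣≡i (ceiling-nonNeg r s e r≃ -e≤s)

⌈frac⌉-nonNeg : ∀ x d .{{_ : ℕ.NonZero d}} → + 0 ℤ.≤ ceiling (frac x d)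
⌈frac⌉-nonNeg x (suc d) =
  ceiling-nonNeg (frac x (suc d)) (+ x) d (ℚ.toℚᵘ-fromℚᵘ (mkℚᵘ (+ x) d))
    (ℤ.≤-trans (ℤ.neg-mono-≤ (ℤ.+≤+ z≤n)) (ℤ.+≤+ z≤n))

∣⌈frac⌉∣-≤ : ∀ x d .{{_ : ℕ.NonZero d}} m → ∣ ceiling (frac x d) ∣ ℕ.≤ m ⇔ x ℕ.≤ m ℕ.* d
∣⌈frac⌉∣-≤ x (suc d) m = ⇔-trans
  (∣ceiling∣-≤ (frac x (suc d)) (+ x) d (ℚ.toℚᵘ-fromℚᵘ (mkℚᵘ (+ x) d))
    (ℤ.≤-trans (ℤ.neg-mono-≤ (ℤ.+≤+ z≤n)) (ℤ.+≤+ z≤n)) m)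
  (mk⇔ ℤ.drop‿+≤+ ℤ.+≤+)

frac-frac≃ : ∀ p q .{{_ : ℕ.NonZero p}} .{{_ : ℕ.NonZero q}} y z →
             toℚᵘ (frac y q ℚ.- frac z p) ℚᵘ.≃
             mkℚᵘ (+ y ℤ.* + p ℤ.+ ℤ.- (+ z) ℤ.* + q) (ℕ.pred (q ℕ.* p))
frac-frac≃ p@(suc c) q@(suc d) y z = ℚᵘ.≃-trans (ℚ.toℚᵘ-homo-+ (frac y q) (ℚ.- frac z p))
  (ℚᵘ.+-cong (ℚ.toℚᵘ-fromℚᵘ (mkℚᵘ (+ y) d))
    (ℚᵘ.≃-trans (ℚ.toℚᵘ-homo‿- (frac z p)) (ℚᵘ.-‿cong (ℚ.toℚᵘ-fromℚᵘ (mkℚᵘ (+ z) c)))))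

-- From z/p < 1 follows y/q - z/p > -1, here with denominators cleared into the form required by
-- `ceiling-nonNeg`.
frac-frac>-1 : ∀ p q .{{_ : ℕ.NonZero q}} y z → z ℕ.< p →
               ℤ.- (+ ℕ.pred (q ℕ.* p)) ℤ.≤ + y ℤ.* + p ℤ.+ ℤ.- (+ z) ℤ.* + q
frac-frac>-1 p@(suc c) q@(suc d) y z z<p = begin
  ℤ.- (+ ℕ.pred (q ℕ.* p))                  ≤⟨ ℤ.neg-mono-≤ (ℤ.+≤+ zq≤) ⟩
  ℤ.- (+ (z ℕ.* q))                         ≡⟨ cong ℤ.-_ (ℤ.pos-* z q) ⟩
  ℤ.- (+ z ℤ.* + q)                         ≡⟨ ℤ.neg-distribˡ-* (+ z) (+ q) ⟩
  ℤ.- (+ z) ℤ.* + q                         ≤⟨ ℤ.i≤j+i _ (+ (y ℕ.* p)) ⟩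
  + (y ℕ.* p) ℤ.+ ℤ.- (+ z) ℤ.* + q         ≡⟨ cong (ℤ._+ ℤ.- (+ z) ℤ.* + q) (ℤ.pos-* y p) ⟩
  + y ℤ.* + p ℤ.+ ℤ.- (+ z) ℤ.* + q         ∎
  where
  open ℤ.≤-Reasoning
  zq≤ : z ℕ.* q ℕ.≤ ℕ.pred (q ℕ.* p)
  zq≤ = ℕ.<⇒≤pred (subst (z ℕ.* q ℕ.<_) (ℕ.*-comm p q) (ℕ.*-monoˡ-< q z<p))

-- Thresholds given by ceilings, and how they shift

gap : ℕ → ℕ → ℕ → ℕ → ℕ
gap p q z y = ∣ ceiling (frac y q ℚ.- frac z p) ∣

+gap : ∀ p q .{{_ : ℕ.NonZero q}} z y → z ℕ.< p → + gap p q z y ≡ ceiling (frac y q ℚ.- frac z p)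
+gap p@(suc _) q z y z<p = ℤ.0≤i⇒+∣i∣≡i
  (ceiling-nonNeg (frac y q ℚ.- frac z p) _ _ (frac-frac≃ p q y z) (frac-frac>-1 p q y z z<p))

-- The right side is p y ≤ q (z + m p), the inequality m ≥ y/q - z/p multiplied by p q. Hence `gap`
-- is the least m for which x = z + m p satisfies x ≥ (p/q) y.
gap-≤ : ∀ p q .{{_ : ℕ.NonZero q}} z y → z ℕ.< p → ∀ m →
        gap p q z y ℕ.≤ m ⇔ p ℕ.* y ℕ.≤ q ℕ.* z ℕ.+ m ℕ.* (p ℕ.* q)
gap-≤ p@(suc _) q@(suc _) z y z<p m = ⇔-trans
  (∣ceiling∣-≤ (frac y q ℚ.- frac z p) _ _ (frac-frac≃ p q y z) (frac-frac>-1 p q y z z<p) m)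
  (mk⇔ (λ h → ℤ.drop‿+≤+ (subst₂ ℤ._≤_ eq₁ eq₂ (ℤ.+-monoʳ-≤ (+ (q ℕ.* z)) h)))
       (λ h → subst₂ ℤ._≤_ eq₃ eq₄ (ℤ.+-monoʳ-≤ (ℤ.- (+ (q ℕ.* z))) (ℤ.+≤+ h))))
  where
  lem₁ : ∀ a b c d → a ℤ.* b ℤ.+ (c ℤ.* d ℤ.+ ℤ.- b ℤ.* a) ≡ d ℤ.* c
  lem₁ = ℤ.solve-∀
  lem₃ : ∀ a b c d → ℤ.- (a ℤ.* b) ℤ.+ d ℤ.* c ≡ c ℤ.* d ℤ.+ ℤ.- b ℤ.* a
  lem₃ = ℤ.solve-∀
  lem₄ : ∀ a b → ℤ.- a ℤ.+ (a ℤ.+ b) ≡ b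
  lem₄ = ℤ.solve-∀
  S = + y ℤ.* + p ℤ.+ ℤ.- (+ z) ℤ.* + q
  eq₁ : + (q ℕ.* z) ℤ.+ S ≡ + (p ℕ.* y)
  eq₁ rewrite ℤ.pos-* q z | ℤ.pos-* p y = lem₁ (+ q) (+ z) (+ y) (+ p)
  eq₃ : ℤ.- (+ (q ℕ.* z)) ℤ.+ + (p ℕ.* y) ≡ S
  eq₃ rewrite ℤ.pos-* q z | ℤ.pos-* p y = lem₃ (+ q) (+ z) (+ y) (+ p)
  eq₂ : + (q ℕ.* z) ℤ.+ + (m ℕ.* (q ℕ.* p)) ≡ + (q ℕ.* z ℕ.+ m ℕ.* (p ℕ.* q))
  eq₂ rewrite ℕ.*-comm p q = sym (ℤ.pos-+ (q ℕ.* z) (m ℕ.* (q ℕ.* p)))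
  eq₄ : ℤ.- (+ (q ℕ.* z)) ℤ.+ + (q ℕ.* z ℕ.+ m ℕ.* (p ℕ.* q)) ≡ + (m ℕ.* (q ℕ.* p))
  eq₄ rewrite ℕ.*-comm p q | ℤ.pos-+ (q ℕ.* z) (m ℕ.* (q ℕ.* p)) = lem₄ (+ (q ℕ.* z)) _

-- Here u and v are least solutions m of linear inequalities. Over ℕ the shift by s could be lost to
-- truncation at 0; B < D excludes this, since s D ≤ B + u D < (u + 1) D gives s ≤ u.
threshold-+ : ∀ {A B D s u v} → B ℕ.< D →
              (∀ m → u ℕ.≤ m ⇔ A ℕ.+ s ℕ.* D ℕ.≤ B ℕ.+ m ℕ.* D) →
              (∀ m → v ℕ.≤ m ⇔ A ℕ.≤ B ℕ.+ m ℕ.* D) → u ≡ v ℕ.+ s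
threshold-+ {A} {B} {D} {s} {u} {v} B<D gu gv = ℕ.≤-antisym u≤ ≤u
  where
  reassoc : ∀ B v s D → B ℕ.+ (v ℕ.+ s) ℕ.* D ≡ B ℕ.+ v ℕ.* D ℕ.+ s ℕ.* D
  reassoc = ℕ.solve-∀
  u≤ : u ℕ.≤ v ℕ.+ s
  u≤ = from (gu _) (subst (A ℕ.+ s ℕ.* D ℕ.≤_) (sym (reassoc B v s D))
         (ℕ.+-monoˡ-≤ (s ℕ.* D) (to (gv v) ℕ.≤-refl)))
  s≤u : s ℕ.≤ u
  s≤u = ℕ.m<1+n⇒m≤n (ℕ.*-cancelʳ-< D s (suc u) (ℕ.≤-<-trans
          (ℕ.≤-trans (ℕ.m≤n+m (s ℕ.* D) A) (to (gu u) ℕ.≤-refl)) (ℕ.+-monoˡ-< (u ℕ.* D) B<D)))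
  ≤u : v ℕ.+ s ℕ.≤ u
  ≤u = subst (v ℕ.+ s ℕ.≤_) (ℕ.m∸n+n≡m s≤u) (ℕ.+-monoˡ-≤ s (from (gv (u ℕ.∸ s))
         (ℕ.+-cancelʳ-≤ (s ℕ.* D) A _ (subst (A ℕ.+ s ℕ.* D ℕ.≤_)
           (trans (cong (λ t → B ℕ.+ t ℕ.* D) (sym (ℕ.m∸n+n≡m s≤u))) (reassoc B (u ℕ.∸ s) s D))
           (to (gu u) ℕ.≤-refl)))))

gap-+ : ∀ p q .{{_ : ℕ.NonZero q}} z y → z ℕ.< p → gap p q z (y ℕ.+ q) ≡ gap p q z y ℕ.+ 1
gap-+ p q z y z<p = threshold-+
  {B = q ℕ.* z} {D = p ℕ.* q} (subst (q ℕ.* z ℕ.<_) (ℕ.*-comm q p) (ℕ.*-monoʳ-< q z<p))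
  (λ m → subst (λ t → gap p q z (y ℕ.+ q) ℕ.≤ m ⇔ t ℕ.≤ q ℕ.* z ℕ.+ m ℕ.* (p ℕ.* q)) (lem p q y)
           (gap-≤ p q z (y ℕ.+ q) z<p m))
  (gap-≤ p q z y z<p)
  where
  lem : ∀ p q y → p ℕ.* (y ℕ.+ q) ≡ p ℕ.* y ℕ.+ 1 ℕ.* (p ℕ.* q)
  lem = ℕ.solve-∀

-- The least λ₁ compatible with λ₂ = y. As λ₁ is summed with period 1 rather than a₁, its threshold
-- is ⌈p y / q⌉ instead of a `gap`.
firstGap : ℕ → ℕ → ℕ → ℕ
firstGap p q y = ∣ ceiling (frac (p ℕ.* y) q) ∣

+firstGap : ∀ p q .{{_ : ℕ.NonZero q}} y → + firstGap p q y ≡ ceiling (frac (p ℕ.* y) q)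
+firstGap p q y = ℤ.0≤i⇒+∣i∣≡i (⌈frac⌉-nonNeg (p ℕ.* y) q)

firstGap-≤ : ∀ p q .{{_ : ℕ.NonZero q}} y m → firstGap p q y ℕ.≤ m ⇔ p ℕ.* y ℕ.≤ m ℕ.* q
firstGap-≤ p q y = ∣⌈frac⌉∣-≤ (p ℕ.* y) q

firstGap-+ : ∀ p q .{{_ : ℕ.NonZero q}} y → firstGap p q (y ℕ.+ q) ≡ firstGap p q y ℕ.+ p
firstGap-+ p q y = threshold-+ {B = 0} {D = q} (ℕ.>-nonZero⁻¹ q)
  (λ m → subst (λ t → firstGap p q (y ℕ.+ q) ℕ.≤ m ⇔ t ℕ.≤ m ℕ.* q) (ℕ.*-distribˡ-+ p y q)
           (firstGap-≤ p q (y ℕ.+ q) m))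
  (firstGap-≤ p q y)

-- Finite sums and formal power series

open ≡-Reasoning

∑< : ℕ → (ℕ → ℤ) → ℤ
∑< n f = sum {n} (λ i → f (toℕ i))

∑<-cong : ∀ n {f g} → (∀ i → i < n → f i ≡ g i) → ∑< n f ≡ ∑< n g
∑<-cong n f≡g = sum-cong-≗ {n} (λ i → f≡g (toℕ i) (toℕ<n i))

∑<-zero : ∀ n {f} → (∀ i → f i ≡ + 0) → ∑< n f ≡ + 0
∑<-zero n f≡0 = trans (∑<-cong n (λ i _ → f≡0 i)) (sum-replicate-zero n)

∑<-comm : ∀ m n (f : ℕ → ℕ → ℤ) → ∑< m (λ i → ∑< n (λ j → f i j)) ≡ ∑< n (λ j → ∑< m (λ i → f i j))
∑<-comm m n f = ∑-comm {m} {n} (λ i j → f (toℕ i) (toℕ j))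

∑<-minus : ∀ n f g → ∑< n (λ i → f i - g i) ≡ ∑< n f - ∑< n g
∑<-minus zero    f g = refl
∑<-minus (suc n) f g = trans (cong (_+_ (f 0 - g 0)) (∑<-minus n (f ∘ suc) (g ∘ suc)))
                             (lem (f 0) (g 0) _ _)
  where
  lem : ∀ a b c d → a - b + (c - d) ≡ a + c - (b + d)
  lem = ℤ.solve-∀

∑<-suc : ∀ n f → ∑< (suc n) f ≡ ∑< n f + f n
∑<-suc zero    f = trans (ℤ.+-identityʳ (f 0)) (sym (ℤ.+-identityˡ (f 0)))
∑<-suc (suc n) f = trans (cong (_+_ (f 0)) (∑<-suc n (f ∘ suc))) (sym (ℤ.+-assoc (f 0) _ _))

∑<-split : ∀ m n f → ∑< (m ℕ.+ n) f ≡ ∑< m f + ∑< n (λ i → f (m ℕ.+ i))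
∑<-split zero    n f = sym (ℤ.+-identityˡ _)
∑<-split (suc m) n f = trans (cong (_+_ (f 0)) (∑<-split m n (f ∘ suc))) (sym (ℤ.+-assoc (f 0) _ _))

∑<-extend : ∀ {m n} f → m ≤ n → (∀ i → m ≤ i → f i ≡ + 0) → ∑< m f ≡ ∑< n f
∑<-extend {m} {n} f m≤n f≡0 = begin
  ∑< m f                                      ≡⟨ ℤ.+-identityʳ _ ⟨
  ∑< m f + + 0                                ≡⟨ cong (_+_ (∑< m f)) (∑<-zero (n ∸ m) (λ i → f≡0 (m ℕ.+ i) (ℕ.m≤m+n m i))) ⟨
  ∑< m f + ∑< (n ∸ m) (λ i → f (m ℕ.+ i))     ≡⟨ ∑<-split m (n ∸ m) f ⟨
  ∑< (m ℕ.+ (n ∸ m)) f                        ≡⟨ cong (λ l → ∑< l f) (ℕ.m+[n∸m]≡n m≤n) ⟩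
  ∑< n f                                      ∎

∑<-* : ∀ m p f → ∑< (m ℕ.* p) f ≡ ∑< m (λ i → ∑< p (λ z → f (z ℕ.+ i ℕ.* p)))
∑<-* zero    p f = refl
∑<-* (suc m) p f = begin
  ∑< (p ℕ.+ m ℕ.* p) f                                                ≡⟨ ∑<-split p (m ℕ.* p) f ⟩
  ∑< p f + ∑< (m ℕ.* p) (λ x → f (p ℕ.+ x))                           ≡⟨ cong₂ _+_ (∑<-cong p (λ z _ → cong f (sym (ℕ.+-identityʳ z)))) (∑<-* m p (λ x → f (p ℕ.+ x))) ⟩
  ∑< p (λ z → f (z ℕ.+ 0)) + ∑< m (λ i → ∑< p (λ z → f (p ℕ.+ (z ℕ.+ i ℕ.* p))))
    ≡⟨ cong (_+_ (∑< p (λ z → f (z ℕ.+ 0)))) (∑<-cong m (λ i _ → ∑<-cong p (λ z _ → cong f (lem p z (i ℕ.* p))))) ⟩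
  ∑< p (λ z → f (z ℕ.+ 0)) + ∑< m (λ i → ∑< p (λ z → f (z ℕ.+ suc i ℕ.* p))) ∎
  where
  lem : ∀ p z x → p ℕ.+ (z ℕ.+ x) ≡ z ℕ.+ (p ℕ.+ x)
  lem = ℕ.solve-∀

suc-≤ᵇ-suc : ∀ m n → (suc m ≤ᵇ suc n) ≡ (m ≤ᵇ n)
suc-≤ᵇ-suc zero    n = refl
suc-≤ᵇ-suc (suc m) n = refl

-- The differences collapse to g c - g n, and g n vanishes. For c ≥ n the sum is zero, and so is g
-- c.
∑<-telescope : ∀ n (g : ℕ → ℤ) c → (∀ m → n ≤ m → g m ≡ + 0) →
               ∑< n (λ m → if c ≤ᵇ m then g m - g (suc m) else + 0) ≡ g c
∑<-telescope zero    g c       g≡0 = sym (g≡0 c z≤n)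
∑<-telescope (suc n) g zero    g≡0 =
  trans (cong (_+_ (g 0 - g 1)) (∑<-telescope n (g ∘ suc) 0 (λ m → g≡0 (suc m) ∘ s≤s))) (lem (g 0) (g 1))
  where
  lem : ∀ a b → a - b + b ≡ a
  lem = ℤ.solve-∀
∑<-telescope (suc n) g (suc c) g≡0 = trans (ℤ.+-identityˡ _) (trans
  (∑<-cong n (λ m _ → cong (λ t → if t then g (suc m) - g (suc (suc m)) else + 0) (suc-≤ᵇ-suc c m)))
  (∑<-telescope n (g ∘ suc) c (λ m → g≡0 (suc m) ∘ s≤s)))

-- Sums over lists

∑L : ∀ {A : Set} → List A → (A → ℤ) → ℤ
∑L []       f = + 0
∑L (x ∷ xs) f = f x + ∑L xs f

∑L-++ : ∀ {A : Set} (xs ys : List A) f → ∑L (xs ++ ys) f ≡ ∑L xs f + ∑L ys f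
∑L-++ []       ys f = sym (ℤ.+-identityˡ _)
∑L-++ (x ∷ xs) ys f = trans (cong (_+_ (f x)) (∑L-++ xs ys f)) (sym (ℤ.+-assoc (f x) _ _))

∑L-cong : ∀ {A : Set} (xs : List A) {f g : A → ℤ} → (∀ x → f x ≡ g x) → ∑L xs f ≡ ∑L xs g
∑L-cong []       f≡g = refl
∑L-cong (x ∷ xs) f≡g = cong₂ _+_ (f≡g x) (∑L-cong xs f≡g)

∑L-map : ∀ {A B : Set} (h : A → B) xs f → ∑L (map h xs) f ≡ ∑L xs (f ∘ h)
∑L-map h []       f = refl
∑L-map h (x ∷ xs) f = cong (_+_ (f (h x))) (∑L-map h xs f)

∑L-if : ∀ {A : Set} (xs : List A) b f → ∑L xs (λ x → if b then f x else + 0) ≡ (if b then ∑L xs f else + 0)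
∑L-if xs       true  f = refl
∑L-if []       false f = refl
∑L-if (x ∷ xs) false f = trans (ℤ.+-identityˡ _) (∑L-if xs false f)

-- One form for both `box`, where `L` is constant, and `comps`, where the remaining total depends on
-- the head. The function `g` is general because `applyUpTo` recurses through `g ∘ suc`.
∑L-cons : ∀ n (g : ℕ → ℕ) (L : ℕ → List (List ℕ)) f →
          ∑L (concatMap (λ z → map (z ∷_) (L z)) (applyUpTo g n)) f ≡
          ∑< n (λ i → ∑L (L (g i)) (λ zs → f (g i ∷ zs)))
∑L-cons zero    g L f = refl
∑L-cons (suc n) g L f = trans (∑L-++ (map (g 0 ∷_) (L (g 0))) _ f)
  (cong₂ _+_ (∑L-map (g 0 ∷_) (L (g 0)) f) (∑L-cons n (g ∘ suc) L f))

𝟙 : Bool → ℤ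
𝟙 b = if b then + 1 else + 0

length-filterᵇ : ∀ {A : Set} (P : A → Bool) xs → + length (filterᵇ P xs) ≡ ∑L xs (λ x → 𝟙 (P x))
length-filterᵇ P []       = refl
length-filterᵇ P (x ∷ xs) with P x
... | true  = cong (_+_ (+ 1)) (length-filterᵇ P xs)
... | false = trans (length-filterᵇ P xs) (sym (ℤ.+-identityˡ _))

-- The summands are compared only inside the box: the bounds z < a are what make the ceilings in the
-- exponent nonnegative.
∑L-box-cong : ∀ cs {f g : List ℕ → ℤ} → (∀ zs → Pointwise _<_ zs cs → f zs ≡ g zs) →
              ∑L (box cs) f ≡ ∑L (box cs) g
∑L-box-cong []       f≡g = cong (_+ + 0) (f≡g [] [])
∑L-box-cong (c ∷ cs) {f} {g} f≡g = begin
  ∑L (box (c ∷ cs)) f                        ≡⟨ ∑L-cons c id (λ _ → box cs) f ⟩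
  ∑< c (λ z → ∑L (box cs) (λ zs → f (z ∷ zs)))   ≡⟨ ∑<-cong c (λ z z<c → ∑L-box-cong cs (λ zs zs<cs → f≡g (z ∷ zs) (z<c ∷ zs<cs))) ⟩
  ∑< c (λ z → ∑L (box cs) (λ zs → g (z ∷ zs)))   ≡⟨ ∑L-cons c id (λ _ → box cs) g ⟨
  ∑L (box (c ∷ cs)) g                        ∎

-- Multiplication by q^e and by 1 - q^b

shift : ℕ → FPS → FPS
shift zero    f n       = f n
shift (suc e) f zero    = + 0
shift (suc e) f (suc n) = shift e f n

-- Agreement is asked for only up to degree n, because the truncated series match the true ones only
-- below the cut-off.
shift-cong : ∀ e {f g : FPS} n → (∀ m → m ≤ n → f m ≡ g m) → shift e f n ≡ shift e g n
shift-cong zero    n       f≡g = f≡g n ℕ.≤-refl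
shift-cong (suc e) zero    f≡g = refl
shift-cong (suc e) (suc n) f≡g = shift-cong e n (λ m → f≡g m ∘ ℕ.m≤n⇒m≤1+n)

shift-+ : ∀ d e f n → shift (d ℕ.+ e) f n ≡ shift d (shift e f) n
shift-+ zero    e f n       = refl
shift-+ (suc d) e f zero    = refl
shift-+ (suc d) e f (suc n) = shift-+ d e f n

shift-∑< : ∀ e N (F : ℕ → FPS) n → shift e (λ m → ∑< N (λ i → F i m)) n ≡ ∑< N (λ i → shift e (F i) n)
shift-∑< zero    N F n       = refl
shift-∑< (suc e) N F zero    = sym (∑<-zero N (λ _ → refl))
shift-∑< (suc e) N F (suc n) = shift-∑< e N F n

shift-if : ∀ e b f n → shift e (λ m → if b then f m else + 0) n ≡ (if b then shift e f n else + 0)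
shift-if e       true  f n       = refl
shift-if zero    false f n       = refl
shift-if (suc e) false f zero    = refl
shift-if (suc e) false f (suc n) = shift-if e false f n

shift-> : ∀ {e n} f → n < e → shift e f n ≡ + 0
shift-> {suc e} {zero}  f n<e       = refl
shift-> {suc e} {suc n} f (s≤s n<e) = shift-> {e} f n<e

shift-≤ : ∀ {e n} f → e ≤ n → shift e f n ≡ f (n ∸ e)
shift-≤ f z≤n       = refl
shift-≤ f (s≤s e≤n) = shift-≤ f e≤n

shift-one : ∀ e n → shift e one n ≡ qpow e n
shift-one zero    zero    = refl
shift-one zero    (suc n) = refl
shift-one (suc e) zero    = refl
shift-one (suc e) (suc n) = shift-one e n

Δ : ℕ → FPS → FPS
Δ b f n = f n - shift b f n

Δ-cong : ∀ b {f g : FPS} n → (∀ m → m ≤ n → f m ≡ g m) → Δ b f n ≡ Δ b g n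
Δ-cong b n f≡g = cong₂ _-_ (f≡g n ℕ.≤-refl) (shift-cong b n f≡g)

Δ-∑< : ∀ b N (F : ℕ → FPS) n → Δ b (λ m → ∑< N (λ i → F i m)) n ≡ ∑< N (λ i → Δ b (F i) n)
Δ-∑< b N F n = trans (cong (_-_ (∑< N (λ i → F i n))) (shift-∑< b N F n))
                     (sym (∑<-minus N (λ i → F i n) (λ i → shift b (F i) n)))

-- Multiplication by the product of 1 - q^(β j) for j < r. The factor for `β 0` acts first, in the
-- order in which the variables are eliminated.
iterΔ : (ℕ → ℕ) → ℕ → FPS → FPS
iterΔ β zero    f = f
iterΔ β (suc r) f = iterΔ (β ∘ suc) r (Δ (β 0) f)

iterΔ-cong : ∀ β r {f g : FPS} n → (∀ m → m ≤ n → f m ≡ g m) → iterΔ β r f n ≡ iterΔ β r g n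
iterΔ-cong β zero    n f≡g = f≡g n ℕ.≤-refl
iterΔ-cong β (suc r) n f≡g =
  iterΔ-cong (β ∘ suc) r n (λ m m≤n → Δ-cong (β 0) m (λ l l≤m → f≡g l (ℕ.≤-trans l≤m m≤n)))

iterΔ-∑< : ∀ β r N (F : ℕ → FPS) n →
           iterΔ β r (λ m → ∑< N (λ i → F i m)) n ≡ ∑< N (λ i → iterΔ β r (F i) n)
iterΔ-∑< β zero    N F n = refl
iterΔ-∑< β (suc r) N F n = trans (iterΔ-cong (β ∘ suc) r n (λ m _ → Δ-∑< (β 0) N F m))
                                 (iterΔ-∑< (β ∘ suc) r N (λ i → Δ (β 0) (F i)) n)

-- Peels off the outermost factor, as `prodS` does, whereas the definition peels off the innermost.
iterΔ-suc : ∀ β r f n → iterΔ β (suc r) f n ≡ Δ (β r) (iterΔ β r f) n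
iterΔ-suc β zero    f n = refl
iterΔ-suc β (suc r) f n = iterΔ-suc (β ∘ suc) r (Δ (β 0) f) n

-- Cauchy products with the denominator

sumℤ-0 : ∀ f n → sumℤ f 0 n ≡ ∑< (suc n) f
sumℤ-0 f zero    = sym (ℤ.+-identityʳ (f 0))
sumℤ-0 f (suc n) = trans (cong (_+ f (suc n)) (sumℤ-0 f n)) (sym (∑<-suc (suc n) f))

sumℤ-2 : ∀ f n → sumℤ f 2 (suc n) ≡ ∑< n (λ j → f (2 ℕ.+ j))
sumℤ-2 f zero    = refl
sumℤ-2 f (suc n) = trans (cong (_+ f (2 ℕ.+ n)) (sumℤ-2 f n)) (sym (∑<-suc n (λ j → f (2 ℕ.+ j))))

⋆-cong : ∀ f {g h : FPS} n → (∀ m → g m ≡ h m) → (f ⋆ g) n ≡ (f ⋆ h) n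
⋆-cong f {g} {h} n g≡h = trans (sumℤ-0 (λ i → f i * g (n ∸ i)) n) (trans
  (∑<-cong (suc n) (λ i _ → cong (f i *_) (g≡h (n ∸ i))))
  (sym (sumℤ-0 (λ i → f i * h (n ∸ i)) n)))

-- Shifting the right factor once kills the last term of the convolution and lowers the degree of g
-- by one in all others.
⋆-shift : ∀ f b g n → (f ⋆ shift b g) n ≡ shift b (f ⋆ g) n
⋆-shift f zero    g n       = refl
⋆-shift f (suc b) g zero    = ℤ.*-zeroʳ (f 0)
⋆-shift f (suc b) g (suc n) = begin
  (f ⋆ shift (suc b) g) (suc n)
    ≡⟨ cong₂ _+_ (sumℤ-0 (λ i → f i * shift (suc b) g (suc n ∸ i)) n)
                 (trans (cong (λ m → f (suc n) * shift (suc b) g m) (ℕ.n∸n≡0 n)) (ℤ.*-zeroʳ (f (suc n)))) ⟩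
  ∑< (suc n) (λ i → f i * shift (suc b) g (suc n ∸ i)) + + 0
    ≡⟨ ℤ.+-identityʳ _ ⟩
  ∑< (suc n) (λ i → f i * shift (suc b) g (suc n ∸ i))
    ≡⟨ ∑<-cong (suc n) (λ i i<1+n → cong (λ m → f i * shift (suc b) g m) (ℕ.+-∸-assoc 1 (ℕ.m<1+n⇒m≤n i<1+n))) ⟩
  ∑< (suc n) (λ i → f i * shift b g (n ∸ i))
    ≡⟨ sumℤ-0 (λ i → f i * shift b g (n ∸ i)) n ⟨
  (f ⋆ shift b g) n
    ≡⟨ ⋆-shift f b g n ⟩
  shift b (f ⋆ g) n ∎

⋆-one : ∀ f n → (f ⋆ one) n ≡ f n
⋆-one f zero    = ℤ.*-identityʳ (f 0)
⋆-one f (suc n) = begin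
  (f ⋆ one) (suc n)
    ≡⟨ cong₂ _+_ (sumℤ-0 (λ i → f i * one (suc n ∸ i)) n)
                 (trans (cong (λ m → f (suc n) * one m) (ℕ.n∸n≡0 n)) (ℤ.*-identityʳ (f (suc n)))) ⟩
  ∑< (suc n) (λ i → f i * one (suc n ∸ i)) + f (suc n)
    ≡⟨ cong (_+ f (suc n)) (trans (∑<-cong (suc n) vanish) (∑<-zero (suc n) (λ _ → refl))) ⟩
  + 0 + f (suc n)
    ≡⟨ ℤ.+-identityˡ _ ⟩
  f (suc n) ∎
  where
  vanish : ∀ i → i < suc n → f i * one (suc n ∸ i) ≡ + 0
  vanish i i<1+n = trans (cong (λ m → f i * one m) (ℕ.+-∸-assoc 1 (ℕ.m<1+n⇒m≤n i<1+n))) (ℤ.*-zeroʳ (f i))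

⋆-Δ : ∀ f b g n → (f ⋆ Δ b g) n ≡ Δ b (f ⋆ g) n
⋆-Δ f b g n = begin
  (f ⋆ Δ b g) n
    ≡⟨ sumℤ-0 (λ i → f i * Δ b g (n ∸ i)) n ⟩
  ∑< (suc n) (λ i → f i * (g (n ∸ i) - shift b g (n ∸ i)))
    ≡⟨ ∑<-cong (suc n) (λ i _ → distrib (f i) (g (n ∸ i)) (shift b g (n ∸ i))) ⟩
  ∑< (suc n) (λ i → f i * g (n ∸ i) - f i * shift b g (n ∸ i))
    ≡⟨ ∑<-minus (suc n) (λ i → f i * g (n ∸ i)) (λ i → f i * shift b g (n ∸ i)) ⟩
  ∑< (suc n) (λ i → f i * g (n ∸ i)) - ∑< (suc n) (λ i → f i * shift b g (n ∸ i))
    ≡⟨ cong₂ _-_ (sumℤ-0 (λ i → f i * g (n ∸ i)) n) (sumℤ-0 (λ i → f i * shift b g (n ∸ i)) n) ⟨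
  (f ⋆ g) n - (f ⋆ shift b g) n
    ≡⟨ cong (_-_ ((f ⋆ g) n)) (⋆-shift f b g n) ⟩
  Δ b (f ⋆ g) n ∎
  where
  distrib : ∀ a b c → a * (b - c) ≡ a * b - a * c
  distrib = ℤ.solve-∀

⋆-oneMinusQ : ∀ f b n → (f ⋆ oneMinusQ b) n ≡ Δ b f n
⋆-oneMinusQ f b n = begin
  (f ⋆ oneMinusQ b) n   ≡⟨ ⋆-cong f n (λ m → cong (_-_ (one m)) (sym (shift-one b m))) ⟩
  (f ⋆ Δ b one) n       ≡⟨ ⋆-Δ f b one n ⟩
  Δ b (f ⋆ one) n       ≡⟨ Δ-cong b n (λ m _ → ⋆-one f m) ⟩
  Δ b f n               ∎

-- Each factor 1 - q^b on the right becomes an operator `Δ` that moves out of the product by `⋆-Δ`,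
-- which takes the place of associativity of `⋆`.
⋆-prodS : ∀ f (β : ℕ → ℕ) k n → (f ⋆ prodS (λ i → oneMinusQ (β i)) 1 k) n ≡ iterΔ (β ∘ suc) k f n
⋆-prodS f β zero    n = ⋆-one f n
⋆-prodS f β (suc k) n = begin
  (f ⋆ (P ⋆ oneMinusQ (β (suc k)))) n   ≡⟨ ⋆-cong f n (⋆-oneMinusQ P (β (suc k))) ⟩
  (f ⋆ Δ (β (suc k)) P) n               ≡⟨ ⋆-Δ f (β (suc k)) P n ⟩
  Δ (β (suc k)) (f ⋆ P) n               ≡⟨ Δ-cong (β (suc k)) n (λ m _ → ⋆-prodS f β k m) ⟩
  Δ (β (suc k)) (iterΔ (β ∘ suc) k f) n ≡⟨ iterΔ-suc (β ∘ suc) k f n ⟨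
  iterΔ (β ∘ suc) (suc k) f n           ∎
  where P = prodS (λ i → oneMinusQ (β i)) 1 k

-- Eliminating the variables one at a time

-- The bound `≥id` makes values x ≥ N contribute only to powers of q from q^N on, which justifies
-- the truncation.
record Quasiperiodic (p b : ℕ) (e : ℕ → ℕ) : Set where
  field
    period : ∀ x → e (x ℕ.+ p) ≡ e x ℕ.+ b
    ≥id    : ∀ x → x ≤ e x

  period* : ∀ z m → e (z ℕ.+ m ℕ.* p) ≡ e z ℕ.+ m ℕ.* b
  period* z zero    = trans (cong e (ℕ.+-identityʳ z)) (sym (ℕ.+-identityʳ (e z)))
  period* z (suc m) = begin
    e (z ℕ.+ suc m ℕ.* p)        ≡⟨ cong e (lem z p (m ℕ.* p)) ⟩
    e (z ℕ.+ m ℕ.* p ℕ.+ p)      ≡⟨ period (z ℕ.+ m ℕ.* p) ⟩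
    e (z ℕ.+ m ℕ.* p) ℕ.+ b      ≡⟨ cong (ℕ._+ b) (period* z m) ⟩
    e z ℕ.+ m ℕ.* b ℕ.+ b        ≡⟨ lem (e z) b (m ℕ.* b) ⟨
    e z ℕ.+ suc m ℕ.* b          ∎
    where
    lem : ∀ x y w → x ℕ.+ (y ℕ.+ w) ≡ x ℕ.+ w ℕ.+ y
    lem = ℕ.solve-∀

precedes : ℕ → ℕ → ℕ → ℕ → Bool
precedes p q x y = p ℕ.* y ≤ᵇ q ℕ.* x

-- next m₀ b e z is the exponent function, in the following variable y, left over once the
-- current variable is summed out from its least admissible value congruent to z.
next : (ℕ → ℕ → ℕ) → ℕ → (ℕ → ℕ) → ℕ → ℕ → ℕ
next m₀ b e z y = e z ℕ.+ m₀ z y ℕ.* b ℕ.+ y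

-- With α j = a_{i+j}, β j = b_{i+j} and z = z_i, this is the part of the numerator's exponent
-- contributed by z_{i+1}, ..., z_k and the ceilings linking them to z_i.
tailExpo : (ℕ → ℕ) → (ℕ → ℕ) → ℕ → List ℕ → ℕ
tailExpo α β z []       = 0
tailExpo α β z (y ∷ zs) = gap (α 0) (α 1) z y ℕ.* β 0 ℕ.+ y ℕ.+ tailExpo (α ∘ suc) (β ∘ suc) y zs

-- Raising y by q raises the gap by one, adding b, and y itself adds q. This is the recursion
-- b_{i+1} = b_i + a_{i+1}.
next-quasiperiodic : ∀ p q b e z .{{_ : ℕ.NonZero q}} → z < p →
                     Quasiperiodic q (b ℕ.+ q) (next (gap p q) b e z)
next-quasiperiodic p q b e z z<p = record
  { period = λ y → trans (cong (λ g → e z ℕ.+ g ℕ.* b ℕ.+ (y ℕ.+ q)) (gap-+ p q z y z<p))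
                         (lem (e z) (gap p q z y) b y q)
  ; ≥id    = λ y → ℕ.m≤n+m y _
  }
  where
  lem : ∀ e g b y q → e ℕ.+ (g ℕ.+ 1) ℕ.* b ℕ.+ (y ℕ.+ q) ≡ e ℕ.+ g ℕ.* b ℕ.+ y ℕ.+ (b ℕ.+ q)
  lem = ℕ.solve-∀

precedes-gap : ∀ p q .{{_ : ℕ.NonZero q}} z m y → z < p → precedes p q (z ℕ.+ m ℕ.* p) y ≡ (gap p q z y ≤ᵇ m)
precedes-gap p q z m y z<p = T-⇔⇒≡ (⇔-trans ≤ᵇ-⇔ (⇔-trans
  (subst (λ t → p ℕ.* y ≤ q ℕ.* (z ℕ.+ m ℕ.* p) ⇔ p ℕ.* y ≤ t) (lem q z m p) (mk⇔ id id))
  (⇔-trans (⇔-sym (gap-≤ p q z y z<p m)) (⇔-sym ≤ᵇ-⇔))))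
  where
  lem : ∀ q z m p → q ℕ.* (z ℕ.+ m ℕ.* p) ≡ q ℕ.* z ℕ.+ m ℕ.* (p ℕ.* q)
  lem = ℕ.solve-∀

precedes-firstGap : ∀ p q .{{_ : ℕ.NonZero q}} m y → precedes p q m y ≡ (firstGap p q y ≤ᵇ m)
precedes-firstGap p q m y = T-⇔⇒≡ (⇔-trans ≤ᵇ-⇔ (⇔-trans
  (subst (λ t → p ℕ.* y ≤ q ℕ.* m ⇔ p ℕ.* y ≤ t) (ℕ.*-comm q m) (mk⇔ id id))
  (⇔-trans (⇔-sym (firstGap-≤ p q y m)) (⇔-sym ≤ᵇ-⇔))))

-- Splitting admissibility into successive constraints

if-zero : ∀ b → (if b then + 0 else + 0) ≡ + 0
if-zero true  = refl
if-zero false = refl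

if-minus : ∀ b x y → (if b then x else + 0) - (if b then y else + 0) ≡ (if b then x - y else + 0)
if-minus true  x y = refl
if-minus false x y = refl

if-∧ : ∀ b c → 𝟙 (b ∧ c) ≡ (if b then 𝟙 c else + 0)
if-∧ true  c = refl
if-∧ false c = refl

-- `allFrom` grows at its upper end, but elimination starts from the first constraint.
allFrom-suc : ∀ P h → allFrom P 1 (suc h) ≡ P 1 ∧ allFrom (P ∘ suc) 1 h
allFrom-suc P zero    = sym (∧-identityʳ (P 1))
allFrom-suc P (suc h) = trans (cong (_∧ P (suc (suc h))) (allFrom-suc P h))
                              (∧-assoc (P 1) (allFrom (P ∘ suc) 1 h) (P (suc (suc h))))

allFrom-cong : ∀ {P Q} h → (∀ i → P (suc i) ≡ Q (suc i)) → allFrom P 1 h ≡ allFrom Q 1 h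
allFrom-cong zero    P≡Q = refl
allFrom-cong (suc h) P≡Q = cong₂ _∧_ (allFrom-cong h P≡Q) (P≡Q h)

admissible-∷ : ∀ r a .{{_ : ℕ.NonZero (a 2)}} x y λs →
               admissible (suc (suc r)) a (x ∷ y ∷ λs) ≡
               precedes (a 1) (a 2) x y ∧ admissible (suc r) (a ∘ suc) (y ∷ λs)
admissible-∷ r a x y λs = trans (allFrom-suc _ r)
  (cong₂ _∧_ (frac-*-≤ᵇ (a 1) (a 2) x y) (allFrom-cong r (λ _ → refl)))

-- Variables are cut off at N, which leaves the coefficients of q^n with n < N unchanged.
module Truncated (N : ℕ) where

  -- Generating function of the r variables following one whose value is x, with α 0 the coefficient
  -- a_i belonging to x.
  tails : (ℕ → ℕ) → ℕ → ℕ → FPS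
  tails α zero    x n = one n
  tails α (suc r) x n =
    ∑< N (λ y → if precedes (α 0) (α 1) x y then shift y (tails (α ∘ suc) r y) n else + 0)

  -- The current variable is summed as well, with weight q^(e x) recording what earlier eliminations
  -- have accumulated.
  chains : (ℕ → ℕ) → ℕ → (ℕ → ℕ) → FPS
  chains α r e n = ∑< N (λ x → shift (e x) (tails α r x) n)

  -- On the residue class of z modulo p the exponents are e z + m b, so the differences telescope
  -- and only the term m = m₀ z survives.
  geometric : ∀ {p b e} .{{_ : ℕ.NonZero p}} → Quasiperiodic p b e →
              (P : ℕ → Bool) (m₀ : ℕ → ℕ) → (∀ z m → z < p → P (z ℕ.+ m ℕ.* p) ≡ (m₀ z ≤ᵇ m)) →
              ∀ U n → n < N →
              ∑< N (λ x → if P x then shift (e x) U n - shift (b ℕ.+ e x) U n else + 0) ≡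
              ∑< p (λ z → shift (e z ℕ.+ m₀ z ℕ.* b) U n)
  geometric {p} {b} {e} qp P m₀ P≡ U n n<N = begin
    -- Enlarging the range to N p makes it a union of complete residue classes; the added terms
    -- vanish because n < N ≤ x ≤ e x.
    ∑< N F                                              ≡⟨ ∑<-extend F (ℕ.m≤m*n N p) F≡0 ⟩
    ∑< (N ℕ.* p) F                                      ≡⟨ ∑<-* N p F ⟩
    ∑< N (λ m → ∑< p (λ z → F (z ℕ.+ m ℕ.* p)))         ≡⟨ ∑<-comm N p (λ m z → F (z ℕ.+ m ℕ.* p)) ⟩
    ∑< p (λ z → ∑< N (λ m → F (z ℕ.+ m ℕ.* p)))
      ≡⟨ ∑<-cong p (λ z z<p → trans (∑<-cong N (λ m _ → F≡G z m z<p)) (∑<-telescope N (G z) (m₀ z) (G≡0 z))) ⟩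
    ∑< p (λ z → G z (m₀ z))                             ∎
    where
    open Quasiperiodic qp
    F : ℕ → ℤ
    F x = if P x then shift (e x) U n - shift (b ℕ.+ e x) U n else + 0
    G : ℕ → ℕ → ℤ
    G z m = shift (e z ℕ.+ m ℕ.* b) U n
    F≡0 : ∀ x → N ≤ x → F x ≡ + 0
    F≡0 x N≤x = trans (cong₂ (λ s t → if P x then s - t else + 0)
        (shift-> U n<e) (shift-> U (ℕ.<-≤-trans n<e (ℕ.m≤n+m (e x) b)))) (if-zero (P x))
      where
      n<e : n < e x
      n<e = ℕ.<-≤-trans n<N (ℕ.≤-trans N≤x (≥id x))
    F≡G : ∀ z m → z < p → F (z ℕ.+ m ℕ.* p) ≡ (if m₀ z ≤ᵇ m then G z m - G z (suc m) else + 0)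
    F≡G z m z<p rewrite P≡ z m z<p | period* z m =
      cong (λ t → if m₀ z ≤ᵇ m then G z m - shift t U n else + 0) (lem b (e z) (m ℕ.* b))
      where
      lem : ∀ b e x → b ℕ.+ (e ℕ.+ x) ≡ e ℕ.+ (b ℕ.+ x)
      lem = ℕ.solve-∀
    -- m ≤ z + m p ≤ e (z + m p) = e z + m b, so the exponent exceeds n once m ≥ N.
    G≡0 : ∀ z m → N ≤ m → G z m ≡ + 0
    G≡0 z m N≤m = shift-> U (ℕ.<-≤-trans n<N (ℕ.≤-trans N≤m (m≤ez+mb m)))
      where
      m≤ez+mb : ∀ m → m ≤ e z ℕ.+ m ℕ.* b
      m≤ez+mb m = subst (m ≤_) (period* z m)
        (ℕ.≤-trans (ℕ.≤-trans (ℕ.m≤m*n m p) (ℕ.m≤n+m (m ℕ.* p) z)) (≥id _))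

  Δ-chains-zero : ∀ α {p b e} .{{_ : ℕ.NonZero p}} → Quasiperiodic p b e → ∀ n → n < N →
                  Δ b (chains α 0 e) n ≡ ∑< p (λ z → qpow (e z) n)
  Δ-chains-zero α {p} {b} {e} qp n n<N = begin
    Δ b (chains α 0 e) n
      ≡⟨ Δ-∑< b N (λ x → shift (e x) one) n ⟩
    ∑< N (λ x → shift (e x) one n - shift b (shift (e x) one) n)
      ≡⟨ ∑<-cong N (λ x _ → cong (_-_ (shift (e x) one n)) (sym (shift-+ b (e x) one n))) ⟩
    ∑< N (λ x → shift (e x) one n - shift (b ℕ.+ e x) one n)
      -- The last variable is constrained only by λ_k ≥ 0, so every threshold is 0.
      ≡⟨ geometric qp (λ _ → true) (λ _ → 0) (λ _ _ _ → refl) one n n<N ⟩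
    ∑< p (λ z → shift (e z ℕ.+ 0) one n)
      ≡⟨ ∑<-cong p (λ z _ → trans (cong (λ t → shift t one n) (ℕ.+-identityʳ (e z))) (shift-one (e z) n)) ⟩
    ∑< p (λ z → qpow (e z) n) ∎

  shift-tails : ∀ α r x d n → shift d (tails α (suc r) x) n ≡
    ∑< N (λ y → if precedes (α 0) (α 1) x y then shift d (shift y (tails (α ∘ suc) r y)) n else + 0)
  shift-tails α r x d n = trans
    (shift-∑< d N (λ y m → if precedes (α 0) (α 1) x y then shift y (tails (α ∘ suc) r y) m else + 0) n)
    (∑<-cong N (λ y _ → shift-if d (precedes (α 0) (α 1) x y) (shift y (tails (α ∘ suc) r y)) n))

  -- For a fixed next value y the constraint is a threshold on m, so the sum over y is moved outside
  -- before telescoping in x and inside again afterwards. The threshold `m₀` is a parameter so as to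
  -- cover both `firstGap` and `gap`.
  Δ-chains-suc : ∀ α r {p b e} .{{_ : ℕ.NonZero p}} → Quasiperiodic p b e → (m₀ : ℕ → ℕ → ℕ) →
                 (∀ z m y → z < p → precedes (α 0) (α 1) (z ℕ.+ m ℕ.* p) y ≡ (m₀ z y ≤ᵇ m)) →
                 ∀ n → n < N →
                 Δ b (chains α (suc r) e) n ≡ ∑< p (λ z → chains (α ∘ suc) r (next m₀ b e z) n)
  Δ-chains-suc α r {p} {b} {e} qp m₀ P≡ n n<N = begin
    Δ b (chains α (suc r) e) n
      ≡⟨ Δ-∑< b N (λ x → shift (e x) (tails α (suc r) x)) n ⟩
    ∑< N (λ x → shift (e x) (tails α (suc r) x) n - shift b (shift (e x) (tails α (suc r) x)) n)
      ≡⟨ ∑<-cong N (λ x _ → expand x) ⟩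
    ∑< N (λ x → ∑< N (λ y → if P x y then shift (e x) (U y) n - shift (b ℕ.+ e x) (U y) n else + 0))
      ≡⟨ ∑<-comm N N (λ x y → if P x y then shift (e x) (U y) n - shift (b ℕ.+ e x) (U y) n else + 0) ⟩
    ∑< N (λ y → ∑< N (λ x → if P x y then shift (e x) (U y) n - shift (b ℕ.+ e x) (U y) n else + 0))
      ≡⟨ ∑<-cong N (λ y _ → geometric qp (λ x → P x y) (λ z → m₀ z y) (λ z m → P≡ z m y) (U y) n n<N) ⟩
    ∑< N (λ y → ∑< p (λ z → shift (e z ℕ.+ m₀ z y ℕ.* b) (U y) n))
      ≡⟨ ∑<-comm N p (λ y z → shift (e z ℕ.+ m₀ z y ℕ.* b) (U y) n) ⟩
    ∑< p (λ z → ∑< N (λ y → shift (e z ℕ.+ m₀ z y ℕ.* b) (U y) n))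
      ≡⟨ ∑<-cong p (λ z _ → ∑<-cong N (λ y _ →
           sym (shift-+ (e z ℕ.+ m₀ z y ℕ.* b) y (tails (α ∘ suc) r y) n))) ⟩
    ∑< p (λ z → chains (α ∘ suc) r (next m₀ b e z) n) ∎
    where
    P : ℕ → ℕ → Bool
    P = precedes (α 0) (α 1)
    U : ℕ → FPS
    U y = shift y (tails (α ∘ suc) r y)
    expand : ∀ x → shift (e x) (tails α (suc r) x) n - shift b (shift (e x) (tails α (suc r) x)) n ≡
                   ∑< N (λ y → if P x y then shift (e x) (U y) n - shift (b ℕ.+ e x) (U y) n else + 0)
    expand x = begin
      shift (e x) (tails α (suc r) x) n - shift b (shift (e x) (tails α (suc r) x)) n
        ≡⟨ cong (_-_ (shift (e x) (tails α (suc r) x) n)) (sym (shift-+ b (e x) _ n)) ⟩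
      shift (e x) (tails α (suc r) x) n - shift (b ℕ.+ e x) (tails α (suc r) x) n
        ≡⟨ cong₂ _-_ (shift-tails α r x (e x) n) (shift-tails α r x (b ℕ.+ e x) n) ⟩
      ∑< N (λ y → if P x y then shift (e x) (U y) n else + 0) -
      ∑< N (λ y → if P x y then shift (b ℕ.+ e x) (U y) n else + 0)
        ≡⟨ ∑<-minus N (λ y → if P x y then shift (e x) (U y) n else + 0) (λ y → if P x y then shift (b ℕ.+ e x) (U y) n else + 0) ⟨
      ∑< N (λ y → (if P x y then shift (e x) (U y) n else + 0) -
                  (if P x y then shift (b ℕ.+ e x) (U y) n else + 0))
        ≡⟨ ∑<-cong N (λ y _ → if-minus (P x y) (shift (e x) (U y) n) (shift (b ℕ.+ e x) (U y) n)) ⟩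
      ∑< N (λ y → if P x y then shift (e x) (U y) n - shift (b ℕ.+ e x) (U y) n else + 0) ∎

  -- Induction on the number of later variables: one `Δ` replaces the current variable by its
  -- residue z and passes to the exponent function `next`. The residues collected on the way range
  -- over the box.
  iterΔ-chains : ∀ r α β e → (∀ j → j ≤ r → 0 < α j) → (∀ j → β (suc j) ≡ β j ℕ.+ α (suc j)) →
                 Quasiperiodic (α 0) (β 0) e → ∀ n → n < N →
                 iterΔ β (suc r) (chains α r e) n ≡
                 ∑< (α 0) (λ z → ∑L (box (applyUpTo (α ∘ suc) r)) (λ zs → qpow (e z ℕ.+ tailExpo α β z zs) n))
  iterΔ-chains zero α β e α>0 β-suc qp n n<N = trans
    (Δ-chains-zero α {{ℕ.>-nonZero (α>0 0 z≤n)}} qp n n<N)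
    (∑<-cong (α 0) (λ z _ → trans (cong (λ t → qpow t n) (sym (ℕ.+-identityʳ (e z)))) (sym (ℤ.+-identityʳ _))))
  iterΔ-chains (suc r) α β e α>0 β-suc qp n n<N = begin
    iterΔ (β ∘ suc) (suc r) (Δ (β 0) (chains α (suc r) e)) n
      ≡⟨ iterΔ-cong (β ∘ suc) (suc r) n (λ m m≤n → Δ-chains-suc α r qp (gap (α 0) (α 1))
           (precedes-gap (α 0) (α 1)) m (ℕ.≤-<-trans m≤n n<N)) ⟩
    iterΔ (β ∘ suc) (suc r) (λ m → ∑< (α 0) (λ z → chains (α ∘ suc) r (e′ z) m)) n
      ≡⟨ iterΔ-∑< (β ∘ suc) (suc r) (α 0) (λ z → chains (α ∘ suc) r (e′ z)) n ⟩
    ∑< (α 0) (λ z → iterΔ (β ∘ suc) (suc r) (chains (α ∘ suc) r (e′ z)) n)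
      ≡⟨ ∑<-cong (α 0) (λ z z<α₀ → iterΔ-chains r (α ∘ suc) (β ∘ suc) (e′ z)
           (λ j j≤r → α>0 (suc j) (s≤s j≤r)) (λ j → β-suc (suc j)) (quasi z z<α₀) n n<N) ⟩
    ∑< (α 0) (λ z → ∑< (α 1) (λ y → ∑L (box cs) (λ zs → qpow (e′ z y ℕ.+ tailExpo (α ∘ suc) (β ∘ suc) y zs) n)))
      ≡⟨ ∑<-cong (α 0) (λ z _ → trans
           (∑<-cong (α 1) (λ y _ → ∑L-cong (box cs) (λ zs → cong (λ t → qpow t n)
              (lem (e z) (gap (α 0) (α 1) z y ℕ.* β 0) y (tailExpo (α ∘ suc) (β ∘ suc) y zs)))))
           (sym (∑L-cons (α 1) id (λ _ → box cs) (λ zs → qpow (e z ℕ.+ tailExpo α β z zs) n)))) ⟩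
    ∑< (α 0) (λ z → ∑L (box (α 1 ∷ cs)) (λ zs → qpow (e z ℕ.+ tailExpo α β z zs) n)) ∎
    where
    instance
      α₀≢0 : ℕ.NonZero (α 0)
      α₀≢0 = ℕ.>-nonZero (α>0 0 z≤n)
      α₁≢0 : ℕ.NonZero (α 1)
      α₁≢0 = ℕ.>-nonZero (α>0 1 (s≤s z≤n))
    cs : List ℕ
    cs = applyUpTo (λ j → α (suc (suc j))) r
    e′ : ℕ → ℕ → ℕ
    e′ = next (gap (α 0) (α 1)) (β 0) e
    quasi : ∀ z → z < α 0 → Quasiperiodic (α 1) (β 1) (e′ z)
    quasi z z<α₀ = subst (λ t → Quasiperiodic (α 1) t (e′ z)) (sym (β-suc 0))
                     (next-quasiperiodic (α 0) (α 1) (β 0) e z z<α₀)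
    lem : ∀ e g y t → e ℕ.+ g ℕ.+ y ℕ.+ t ≡ e ℕ.+ (g ℕ.+ y ℕ.+ t)
    lem = ℕ.solve-∀

  -- A first part j leaves total m - j, which is a shift by j. Shifts by j > m vanish, so j may run
  -- up to N.
  ∑L-comps-suc : ∀ r m → m < N → (f : List ℕ → ℤ) (P : ℕ → Bool) (t : ℕ → FPS) →
                 (∀ j l → l ≤ m → ∑L (comps r l) (λ λs → f (j ∷ λs)) ≡ (if P j then t j l else + 0)) →
                 ∑L (comps (suc r) m) f ≡ ∑< N (λ j → if P j then shift j (t j) m else + 0)
  ∑L-comps-suc r m m<N f P t f≡ = begin
    ∑L (comps (suc r) m) f
      ≡⟨ ∑L-cons (suc m) id (λ j → comps r (m ∸ j)) f ⟩
    ∑< (suc m) (λ j → ∑L (comps r (m ∸ j)) (λ λs → f (j ∷ λs)))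
      ≡⟨ ∑<-cong (suc m) (λ j j<1+m → trans (f≡ j (m ∸ j) (ℕ.m∸n≤m m j))
           (cong (λ s → if P j then s else + 0) (sym (shift-≤ (t j) (ℕ.m<1+n⇒m≤n j<1+m))))) ⟩
    ∑< (suc m) (λ j → if P j then shift j (t j) m else + 0)
      ≡⟨ ∑<-extend (λ j → if P j then shift j (t j) m else + 0) m<N
           (λ j m<j → trans (cong (λ s → if P j then s else + 0) (shift-> (t j) m<j)) (if-zero (P j))) ⟩
    ∑< N (λ j → if P j then shift j (t j) m else + 0) ∎

  tails-comps : ∀ r a x m → (∀ j → j ≤ r → 0 < a (suc j)) → m < N →
                ∑L (comps r m) (λ λs → 𝟙 (admissible (suc r) a (x ∷ λs))) ≡ tails (a ∘ suc) r x m
  tails-comps zero    a x zero    a>0 m<N = refl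
  tails-comps zero    a x (suc m) a>0 m<N = refl
  tails-comps (suc r) a x m       a>0 m<N =
    ∑L-comps-suc r m m<N _ (precedes (a 1) (a 2) x) (tails (λ i → a (suc (suc i))) r) λ j l l≤m → begin
      ∑L (comps r l) (λ λs → 𝟙 (admissible (suc (suc r)) a (x ∷ j ∷ λs)))
        ≡⟨ ∑L-cong (comps r l) (λ λs → trans
             (cong 𝟙 (admissible-∷ r a {{ℕ.>-nonZero (a>0 1 (s≤s z≤n))}} x j λs))
             (if-∧ (precedes (a 1) (a 2) x j) _)) ⟩
      ∑L (comps r l) (λ λs → if precedes (a 1) (a 2) x j then 𝟙 (admissible (suc r) (a ∘ suc) (j ∷ λs)) else + 0)
        ≡⟨ ∑L-if (comps r l) (precedes (a 1) (a 2) x j) (λ λs → 𝟙 (admissible (suc r) (a ∘ suc) (j ∷ λs))) ⟩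
      (if precedes (a 1) (a 2) x j then ∑L (comps r l) (λ λs → 𝟙 (admissible (suc r) (a ∘ suc) (j ∷ λs))) else + 0)
        ≡⟨ cong (λ s → if precedes (a 1) (a 2) x j then s else + 0)
             (tails-comps r (a ∘ suc) j l (λ i i≤r → a>0 (suc i) (s≤s i≤r)) (ℕ.≤-<-trans l≤m m<N)) ⟩
      (if precedes (a 1) (a 2) x j then tails (λ i → a (suc (suc i))) r j l else + 0) ∎

  lhsSeries-chains : ∀ r a m → (∀ j → j ≤ r → 0 < a (suc j)) → m < N →
                     lhsSeries (suc r) a m ≡ chains (a ∘ suc) r id m
  lhsSeries-chains r a m a>0 m<N = trans
    (length-filterᵇ (admissible (suc r) a) (comps (suc r) m))
    -- λ₁ has no predecessor, hence the trivial constraint.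
    (∑L-comps-suc r m m<N _ (λ _ → true) (tails (a ∘ suc) r)
      (λ j l l≤m → tails-comps r a j l a>0 (ℕ.≤-<-trans l≤m m<N)))

-- The exponents of the numerator

tailExpo-∑< : ∀ r α β z zs → (∀ j → j ≤ r → 0 < α j) → z < α 0 → Pointwise _<_ zs (applyUpTo (α ∘ suc) r) →
  ∑< (suc r) (λ j → + at (z ∷ zs) (suc j)) +
  ∑< r (λ j → + β j * ceiling (frac (at (z ∷ zs) (2 ℕ.+ j)) (α (suc j)) ℚ.- frac (at (z ∷ zs) (suc j)) (α j)))
  ≡ + (z ℕ.+ tailExpo α β z zs)
tailExpo-∑< zero    α β z []       α>0 z<α₀ []            =
  trans (ℤ.+-identityʳ _) (trans (ℤ.+-identityʳ _) (cong +_ (sym (ℕ.+-identityʳ z))))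
tailExpo-∑< (suc r) α β z (y ∷ zs) α>0 z<α₀ (y<α₁ ∷ zs<α) = begin
  (+ z + A) + (+ β 0 * ceiling (frac y (α 1) ℚ.- frac z (α 0)) + B)
    ≡⟨ regroup (+ z) A (+ β 0 * ceiling (frac y (α 1) ℚ.- frac z (α 0))) B ⟩
  + z + + β 0 * ceiling (frac y (α 1) ℚ.- frac z (α 0)) + (A + B)
    -- The integer ceiling is a natural number here because z < α 0.
    ≡⟨ cong₂ (λ s t → + z + + β 0 * s + t) (sym (+gap (α 0) (α 1) {{ℕ.>-nonZero (α>0 1 (s≤s z≤n))}} z y z<α₀))
         (tailExpo-∑< r (α ∘ suc) (β ∘ suc) y zs (λ j j≤r → α>0 (suc j) (s≤s j≤r)) y<α₁ zs<α) ⟩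
  + z + + β 0 * + g + + (y ℕ.+ t)
    ≡⟨ cong (λ s → + z + s + + (y ℕ.+ t)) (sym (ℤ.pos-* (β 0) g)) ⟩
  + (z ℕ.+ β 0 ℕ.* g ℕ.+ (y ℕ.+ t))
    ≡⟨ cong +_ (lem z (β 0) g y t) ⟩
  + (z ℕ.+ (g ℕ.* β 0 ℕ.+ y ℕ.+ t)) ∎
  where
  A B : ℤ
  A = ∑< (suc r) (λ j → + at (y ∷ zs) (suc j))
  B = ∑< r (λ j → + β (suc j) * ceiling (frac (at (y ∷ zs) (2 ℕ.+ j)) (α (suc (suc j))) ℚ.- frac (at (y ∷ zs) (suc j)) (α (suc j))))
  g t : ℕ
  g = gap (α 0) (α 1) z y
  t = tailExpo (α ∘ suc) (β ∘ suc) y zs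
  regroup : ∀ a b c d → a + b + (c + d) ≡ a + c + (b + d)
  regroup = ℤ.solve-∀
  lem : ∀ z b g y t → z ℕ.+ b ℕ.* g ℕ.+ (y ℕ.+ t) ≡ z ℕ.+ (g ℕ.* b ℕ.+ y ℕ.+ t)
  lem = ℕ.solve-∀

-- The exponent ⌈a₁ y / a₂⌉ + y left after summing out λ₁, whose only residue modulo 1 is 0.
startExpo : (ℕ → ℕ) → ℕ → ℕ
startExpo a = next (λ _ → firstGap (a 1) (a 2)) 1 id 0

expo-tailExpo : ∀ r a z zs → (∀ j → j ≤ r → 0 < a (2 ℕ.+ j)) →
                Pointwise _<_ (z ∷ zs) (applyUpTo (λ j → a (2 ℕ.+ j)) (suc r)) →
                expo (2 ℕ.+ r) a (z ∷ zs) ≡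
                + (startExpo a z ℕ.+ tailExpo (λ j → a (2 ℕ.+ j)) (λ j → bseq a (2 ℕ.+ j)) z zs)
expo-tailExpo r a z zs a>0 (z<a₂ ∷ zs<a) = begin
  expo (2 ℕ.+ r) a (z ∷ zs)
    ≡⟨ cong₂ (λ s t → C + s + t) (sumℤ-2 (λ i → + at (z ∷ zs) (i ∸ 1)) (suc r)) (sumℤ-2 F r) ⟩
  C + ∑< (suc r) (λ j → + at (z ∷ zs) (suc j)) + ∑< r (λ j → F (2 ℕ.+ j))
    ≡⟨ ℤ.+-assoc C _ _ ⟩
  C + (∑< (suc r) (λ j → + at (z ∷ zs) (suc j)) + ∑< r (λ j → F (2 ℕ.+ j)))
    ≡⟨ cong₂ _+_ (sym (+firstGap (a 1) (a 2) {{ℕ.>-nonZero (a>0 0 z≤n)}} z))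
         (tailExpo-∑< r (λ j → a (2 ℕ.+ j)) (λ j → bseq a (2 ℕ.+ j)) z zs a>0 z<a₂ zs<a) ⟩
  + (firstGap (a 1) (a 2) z ℕ.+ (z ℕ.+ t))
    ≡⟨ cong +_ (lem (firstGap (a 1) (a 2) z) z t) ⟩
  + (startExpo a z ℕ.+ t) ∎
  where
  C : ℤ
  C = ceiling (frac (a 1 ℕ.* z) (a 2))
  F : ℕ → ℤ
  F i = + bseq a i * ceiling (frac (at (z ∷ zs) i) (a (suc i)) ℚ.- frac (at (z ∷ zs) (i ∸ 1)) (a i))
  t : ℕ
  t = tailExpo (λ j → a (2 ℕ.+ j)) (λ j → bseq a (2 ℕ.+ j)) z zs
  lem : ∀ g z t → g ℕ.+ (z ℕ.+ t) ≡ 0 ℕ.+ g ℕ.* 1 ℕ.+ z ℕ.+ t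
  lem = ℕ.solve-∀

-- The test applied by numerator is local to its definition; unification recovers it.
numerator-filter : ∀ k a n → Σ (List ℕ → Bool) λ P → numerator k a n ≡ + length (filterᵇ P (box (bounds k a)))
numerator-filter k a n = _ , refl

numerator-test : ∀ k a n zs m → expo k a zs ≡ + m → 𝟙 (proj₁ (numerator-filter k a n) zs) ≡ qpow m n
numerator-test k a n zs m eq rewrite eq = refl

numerator-∑< : ∀ r a n → (∀ j → j ≤ r → 0 < a (2 ℕ.+ j)) →
  numerator (2 ℕ.+ r) a n ≡
  ∑< (a 2) (λ z → ∑L (box (applyUpTo (λ j → a (3 ℕ.+ j)) r)) (λ zs →
    qpow (startExpo a z ℕ.+ tailExpo (λ j → a (2 ℕ.+ j)) (λ j → bseq a (2 ℕ.+ j)) z zs) n))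
numerator-∑< r a n a>0 = begin
  numerator k a n
    ≡⟨ proj₂ (numerator-filter k a n) ⟩
  + length (filterᵇ P (box (bounds k a)))
    ≡⟨ length-filterᵇ P (box (bounds k a)) ⟩
  ∑L (box (bounds k a)) (λ zs → 𝟙 (P zs))
    ≡⟨ cong (λ cs → ∑L (box cs) (λ zs → 𝟙 (P zs))) (map-upTo (λ j → a (2 ℕ.+ j)) (suc r)) ⟩
  ∑L (box (a 2 ∷ cs)) (λ zs → 𝟙 (P zs))
    ≡⟨ ∑L-box-cong (a 2 ∷ cs) {g = G} test ⟩
  ∑L (box (a 2 ∷ cs)) G
    ≡⟨ ∑L-cons (a 2) id (λ _ → box cs) G ⟩
  ∑< (a 2) (λ z → ∑L (box cs) (λ zs → G (z ∷ zs))) ∎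
  where
  k = 2 ℕ.+ r
  cs = applyUpTo (λ j → a (3 ℕ.+ j)) r
  P = proj₁ (numerator-filter k a n)
  G : List ℕ → ℤ
  -- A default value: every list in `box (a 2 ∷ cs)` is nonempty.
  G []       = + 0
  G (z ∷ zs) = qpow (startExpo a z ℕ.+ tailExpo (λ j → a (2 ℕ.+ j)) (λ j → bseq a (2 ℕ.+ j)) z zs) n
  test : ∀ zs → Pointwise _<_ zs (a 2 ∷ cs) → 𝟙 (P zs) ≡ G zs
  test (z ∷ zs) zs<cs = numerator-test k a n (z ∷ zs) _ (expo-tailExpo r a z zs a>0 zs<cs)

theorem2 : (k : ℕ) → 2 ≤ k → (a : ℕ → ℕ) → (∀ i → 1 ≤ i → i ≤ k → 0 < a i) →
    ∀ n → (lhsSeries k a ⋆ denominator k a) n ≡ numerator k a n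
theorem2 (suc (suc r)) (s≤s (s≤s z≤n)) a a>0 n = begin
  (lhsSeries k a ⋆ denominator k a) n
    ≡⟨ ⋆-prodS (lhsSeries k a) (bseq a) k n ⟩
  iterΔ β (suc r) (Δ 1 (lhsSeries k a)) n
    -- λ₁ is eliminated separately: b₂ = a₁ + a₂ does not in general equal b₁ + a₂, so the recursion
    -- required by `iterΔ-chains` starts only at b₂.
    ≡⟨ iterΔ-cong β (suc r) n (λ m m≤n → first m (s≤s m≤n)) ⟩
  iterΔ β (suc r) (chains α r (startExpo a)) n
    ≡⟨ iterΔ-chains r α β (startExpo a) α>0 (λ _ → refl) start-quasiperiodic n (ℕ.n<1+n n) ⟩
  ∑< (a 2) (λ z → ∑L (box (applyUpTo (α ∘ suc) r)) (λ zs → qpow (startExpo a z ℕ.+ tailExpo α β z zs) n))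
    ≡⟨ numerator-∑< r a n α>0 ⟨
  numerator k a n ∎
  where
  -- The least cut-off that preserves the coefficient of q^n.
  open Truncated (suc n)
  k = 2 ℕ.+ r
  α β : ℕ → ℕ
  α j = a (2 ℕ.+ j)
  β j = bseq a (2 ℕ.+ j)
  α>0 : ∀ j → j ≤ r → 0 < α j
  α>0 j j≤r = a>0 (2 ℕ.+ j) (s≤s z≤n) (s≤s (s≤s j≤r))
  instance
    a₂≢0 : ℕ.NonZero (a 2)
    a₂≢0 = ℕ.>-nonZero (α>0 0 z≤n)
  id-quasiperiodic : Quasiperiodic 1 1 id
  id-quasiperiodic = record { period = λ _ → refl ; ≥id = λ _ → ℕ.≤-refl }
  first-gap : ∀ z m y → z < 1 → precedes (a 1) (a 2) (z ℕ.+ m ℕ.* 1) y ≡ (firstGap (a 1) (a 2) y ≤ᵇ m)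
  first-gap zero m y _ = trans (cong (λ x → precedes (a 1) (a 2) x y) (ℕ.*-identityʳ m))
                               (precedes-firstGap (a 1) (a 2) m y)
  first-gap (suc z) m y (s≤s ())
  first : ∀ m → m < suc n → Δ 1 (lhsSeries k a) m ≡ chains α r (startExpo a) m
  first m m<N = begin
    Δ 1 (lhsSeries k a) m
      ≡⟨ Δ-cong 1 m (λ l l≤m → lhsSeries-chains (suc r) a l
           (λ j j≤1+r → a>0 (suc j) (s≤s z≤n) (s≤s j≤1+r)) (ℕ.≤-<-trans l≤m m<N)) ⟩
    Δ 1 (chains (a ∘ suc) (suc r) id) m
      ≡⟨ Δ-chains-suc (a ∘ suc) r id-quasiperiodic (λ _ → firstGap (a 1) (a 2)) first-gap m m<N ⟩
    -- The sum over the single residue z < 1 unfolds to one term plus an empty sum.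
    chains α r (startExpo a) m + + 0
      ≡⟨ ℤ.+-identityʳ _ ⟩
    chains α r (startExpo a) m ∎
  start-quasiperiodic : Quasiperiodic (a 2) (bseq a 2) (startExpo a)
  start-quasiperiodic = record
    { period = λ y → trans (cong (λ g → g ℕ.* 1 ℕ.+ (y ℕ.+ a 2)) (firstGap-+ (a 1) (a 2) y))
                           (lem (firstGap (a 1) (a 2) y) (a 1) (a 2) y)
    ; ≥id    = λ y → ℕ.m≤n+m y _
    }
    where
    lem : ∀ g p q y → (g ℕ.+ p) ℕ.* 1 ℕ.+ (y ℕ.+ q) ≡ g ℕ.* 1 ℕ.+ y ℕ.+ (p ℕ.+ q)
    lem = ℕ.solve-∀
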